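{- Let $R$ be a principal ideal domain and let $I=gR\subsetneq R$ be a proper, non-prime ideal such that $Q:=R/I$ is finite. Suppose that $g=u\cdot p_1^{m_1}p_2^{m_2}$ with $u$ a unit, $p_1,p_2$ non-associated prime elements and integers $m_1,m_2\ge 1$, and let $\bm{m}=(m_1,m_2)$. If $\bm{m}\ne(1,1)$, then the graph $\Gamma_{E'}(Q)$ is isomorphic to the integral covering graph $D(\bm{m})$.
   Context: Rings are commutative and non-zero with $1$. For a ring $Q$, $Z(Q)$ is the set of $r\in Q$ for which there is $s\in Q\setminus\{0\}$ with $rs=0$. The zero divisor graph $\Gamma(Q)$ has vertex set $Z(Q)\setminus\{0\}$; two distinct vertices $r,s$ are adjacent iff $rs=0$. For a graph $G=(V,E)$ with neighbourhoods $N(\cdot)$, define $u\sim' v$ if $N(u)\setminus\{u,v\}=N(v)\setminus\{u,v\}$; this is an equivalence relation, with classes $[v]'$. The graph $G_{E'}$ has vertex set $\{[v]'\colon v\in V\}$ and edge set $\{\{[u]',[v]'\}\colon [u]'\ne[v]' \text{ and } \{u,v\}\in E\}$. $\Gamma_{E'}(Q)$ denotes $G_{E'}$ for $G=\Gamma(Q)$. For $\bm{m}\in\mathbb{Z}_{\ge 1}^n$, the integral covering graph $D(\bm{m})$ has vertex set $\prod_{i=1}^n \{0,1,\dots,m_i\}\setminus\{\bm{0},\bm{m}\}$, and two distinct vertices $\bm v,\bm w$ are adjacent iff $v_i+w_i\ge m_i$ for all $i\in\{1,\dots,n\}$. -}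

module Defs where

open import Level using (Level; _⊔_; suc)
open import Algebra.Bundles using (CommutativeRing; Magma; Semiring)
open import Data.Fin using (Fin)
open import Data.Nat as ℕ using (ℕ)
import Data.Nat.Properties as ℕₚ
open import Data.Product using (Σ; ∃; ∃₂; _×_; _,_; proj₁; proj₂)
open import Data.Sum using (_⊎_)
open import Data.Vec.Functional using (Vector)
open import Function.Base using (_∘_; _on_)
open import Function.Bundles using (Inverse; _⇔_)
open import Function.Properties.Inverse using (Inverse⇒Injection)
open import Relation.Binary.Bundles using (Setoid)
open import Relation.Binary.Core using (Rel)
open import Relation.Binary.Definitions using (Decidable; Symmetric; _Respects₂_)
import Relation.Binary.Construct.On as On
open import Relation.Binary.PropositionalEquality as ≡ using (_≡_; _≗_)
open import Relation.Nullary using (¬_; yes; no)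
open import Relation.Nullary.Decidable using (via-injection)
open import Relation.Unary using (Pred; _≐_)

import Data.Fin.Properties as Finₚ
import Algebra.Definitions.RawSemiring as SemiringDefs
import Algebra.Definitions.RawMagma as MagmaDefs
import Algebra.Properties.Ring as RingProperties
import Algebra.Properties.AbelianGroup as AbelianGroupProperties
import Algebra.Properties.CommutativeSemigroup as CommSemigroupProperties
import Relation.Binary.Reasoning.Setoid as SetoidReasoning

------------------------------------------------------------------------
-- Finite sets

Finite : ∀ {a ℓ} → Setoid a ℓ → Set (a ⊔ ℓ)
Finite S = ∃ λ n → Inverse S (≡.setoid (Fin n))

finite⇒decidable : ∀ {a ℓ} (S : Setoid a ℓ) → Finite S → Decidable (Setoid._≈_ S)
finite⇒decidable S (n , inv) = via-injection (Inverse⇒Injection inv) Finₚ._≟_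

------------------------------------------------------------------------
-- Ideals and principal ideal domains

module RingTheory {c ℓ : Level} (R : CommutativeRing c ℓ) where

  open CommutativeRing R public
  open SemiringDefs (Semiring.rawSemiring semiring) public using (_^_; _∣_; Prime)
  open MagmaDefs (Magma.rawMagma *-magma) public using (_∦_)

  open RingProperties ring using (-1*x≈-x; -‿distribʳ-*)
  open AbelianGroupProperties +-abelianGroup using (⁻¹-∙-comm; ⁻¹-involutive)
  open CommSemigroupProperties +-commutativeSemigroup using (interchange)

  IsUnit : Carrier → Set (c ⊔ ℓ)
  IsUnit u = u ∣ 1#

  record Ideal (p : Level) : Set (c ⊔ ℓ ⊔ suc p) where
    field
      Member   : Pred Carrier p
      resp-≈   : ∀ {x y} → x ≈ y → Member x → Member y
      0∈       : Member 0#
      +-closed : ∀ {x y} → Member x → Member y → Member (x + y)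
      *-closed : ∀ r {x} → Member x → Member (r * x)

    -‿closed : ∀ {x} → Member x → Member (- x)
    -‿closed {x} x∈ = resp-≈ (-1*x≈-x x) (*-closed (- 1#) x∈)

  infix 4 _∈_
  _∈_ : ∀ {p} → Carrier → Ideal p → Set p
  x ∈ I = Ideal.Member I x

  -- g ∣ x unfolds to: q * g ≈ x for some q.
  ⟨_⟩ : Carrier → Ideal (c ⊔ ℓ)
  ⟨ g ⟩ = record
    { Member   = g ∣_
    ; resp-≈   = λ { x≈y (q MagmaDefs., e) → q MagmaDefs., trans e x≈y }
    ; 0∈       = 0# MagmaDefs., zeroˡ g
    ; +-closed = λ { (q MagmaDefs., e) (r MagmaDefs., f) →
                     (q + r) MagmaDefs., trans (distribʳ g q r) (+-cong e f) }
    ; *-closed = λ { r (q MagmaDefs., e) →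
                     (r * q) MagmaDefs., trans (*-assoc r q g) (*-congˡ e) }
    }

  IsProper : ∀ {p} → Ideal p → Set (c ⊔ p)
  IsProper I = ¬ (∀ x → x ∈ I)

  record IsPrimeIdeal {p : Level} (I : Ideal p) : Set (c ⊔ p) where
    field
      proper : IsProper I
      split  : ∀ {x y} → x * y ∈ I → x ∈ I ⊎ y ∈ I

  record IsIntegralDomain : Set (c ⊔ ℓ) where
    field
      1≉0            : 1# ≉ 0#
      noZeroDivisors : ∀ {x y} → x * y ≈ 0# → x ≈ 0# ⊎ y ≈ 0#

  -- Ideals are arbitrary (not necessarily decidable) predicates, as in the
  -- classical definition.  Applied to ideals of the form {x ∣ x ≈ 0 or P},
  -- `principal` decides every proposition P : Set (c ⊔ ℓ).
  record IsPID : Set (suc (c ⊔ ℓ)) where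
    field
      isIntegralDomain : IsIntegralDomain
      principal        : (I : Ideal (c ⊔ ℓ)) → ∃ λ g → (_∈ I) ≐ (_∈ ⟨ g ⟩)

  ----------------------------------------------------------------------
  -- The quotient ring R / I: the same carrier, with congruence modulo I as
  -- its equality

  module _ {p : Level} (I : Ideal p) where
    open Ideal I
    open SetoidReasoning setoid

    private
      infix 4 _≈ᵢ_
      _≈ᵢ_ : Rel Carrier p
      x ≈ᵢ y = x - y ∈ I

      ≈⇒≈ᵢ : ∀ {x y} → x ≈ y → x ≈ᵢ y
      ≈⇒≈ᵢ {x} {y} x≈y = resp-≈ (sym (trans (+-congʳ x≈y) (-‿inverseʳ y))) 0∈

      swap-neg : ∀ x y → - (x - y) ≈ y - x
      swap-neg x y = begin
        - (x - y)      ≈⟨ ⁻¹-∙-comm x (- y) ⟨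
        - x + - (- y)  ≈⟨ +-congˡ (⁻¹-involutive y) ⟩
        - x + y        ≈⟨ +-comm (- x) y ⟩
        y - x          ∎

      symᵢ : ∀ {x y} → x ≈ᵢ y → y ≈ᵢ x
      symᵢ {x} {y} h = resp-≈ (swap-neg x y) (-‿closed h)

      telescope : ∀ x y z → (x - y) + (y - z) ≈ x - z
      telescope x y z = begin
        (x - y) + (y - z)    ≈⟨ +-assoc x (- y) (y - z) ⟩
        x + (- y + (y - z))  ≈⟨ +-congˡ (+-assoc (- y) y (- z)) ⟨
        x + (- y + y - z)    ≈⟨ +-congˡ (+-congʳ (-‿inverseˡ y)) ⟩
        x + (0# - z)         ≈⟨ +-congˡ (+-identityˡ (- z)) ⟩
        x - z                ∎

      transᵢ : ∀ {x y z} → x ≈ᵢ y → y ≈ᵢ z → x ≈ᵢ z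
      transᵢ {x} {y} {z} h k = resp-≈ (telescope x y z) (+-closed h k)

      +-congᵢ : ∀ {x y u v} → x ≈ᵢ y → u ≈ᵢ v → x + u ≈ᵢ y + v
      +-congᵢ {x} {y} {u} {v} h k = resp-≈ eq (+-closed h k)
        where
        eq : (x - y) + (u - v) ≈ (x + u) - (y + v)
        eq = trans (interchange x (- y) u (- v)) (+-congˡ (⁻¹-∙-comm y v))

      *-congˡᵢ : ∀ r {x y} → x ≈ᵢ y → r * x ≈ᵢ r * y
      *-congˡᵢ r {x} {y} h = resp-≈ eq (*-closed r h)
        where
        eq : r * (x - y) ≈ r * x - r * y
        eq = trans (distribˡ r x (- y)) (+-congˡ (sym (-‿distribʳ-* r y)))

      *-congᵢ : ∀ {x y u v} → x ≈ᵢ y → u ≈ᵢ v → x * u ≈ᵢ y * v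
      *-congᵢ {x} {y} {u} {v} h k =
        transᵢ (≈⇒≈ᵢ (*-comm x u))
          (transᵢ (*-congˡᵢ u h) (transᵢ (≈⇒≈ᵢ (*-comm u y)) (*-congˡᵢ y k)))

      -‿congᵢ : ∀ {x y} → x ≈ᵢ y → - x ≈ᵢ - y
      -‿congᵢ {x} {y} h = resp-≈ (sym (⁻¹-∙-comm x (- y))) (-‿closed h)

    quotientRing : CommutativeRing c p
    quotientRing = record
      { Carrier = Carrier
      ; _≈_     = _≈ᵢ_
      ; _+_     = _+_
      ; _*_     = _*_
      ; -_      = -_
      ; 0#      = 0#
      ; 1#      = 1#
      ; isCommutativeRing = record
        { isRing = record
          { +-isAbelianGroup = record
            { isGroup = record
              { isMonoid = record
                { isSemigroup = record
                  { isMagma = record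
                    { isEquivalence = record
                      { refl = ≈⇒≈ᵢ refl ; sym = symᵢ ; trans = transᵢ }
                    ; ∙-cong = +-congᵢ
                    }
                  ; assoc = λ x y z → ≈⇒≈ᵢ (+-assoc x y z)
                  }
                ; identity = (≈⇒≈ᵢ ∘ +-identityˡ) , (≈⇒≈ᵢ ∘ +-identityʳ)
                }
              ; inverse = (≈⇒≈ᵢ ∘ -‿inverseˡ) , (≈⇒≈ᵢ ∘ -‿inverseʳ)
              ; ⁻¹-cong = -‿congᵢ
              }
            ; comm = λ x y → ≈⇒≈ᵢ (+-comm x y)
            }
          ; *-cong     = *-congᵢ
          ; *-assoc    = λ x y z → ≈⇒≈ᵢ (*-assoc x y z)
          ; *-identity = (≈⇒≈ᵢ ∘ *-identityˡ) , (≈⇒≈ᵢ ∘ *-identityʳ)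
          ; distrib    = (λ x y z → ≈⇒≈ᵢ (distribˡ x y z))
                       , (λ x y z → ≈⇒≈ᵢ (distribʳ x y z))
          }
        ; *-comm = λ x y → ≈⇒≈ᵢ (*-comm x y)
        }
      }

------------------------------------------------------------------------
-- Simple graphs

record Graph (v e a : Level) : Set (suc (v ⊔ e ⊔ a)) where
  field
    vertices : Setoid v e
  open Setoid vertices public
    using (_≈_; _≉_) renaming (Carrier to Vertex)
  field
    Adj        : Rel Vertex a
    Adj-resp-≈ : Adj Respects₂ _≈_
    Adj-sym    : Symmetric Adj
    Adj⇒≉      : ∀ {x y} → Adj x y → x ≉ y

infix 4 _≅_
record _≅_ {v e a v′ e′ a′ : Level} (G : Graph v e a) (H : Graph v′ e′ a′)
       : Set (v ⊔ e ⊔ a ⊔ v′ ⊔ e′ ⊔ a′) where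
  private
    module G = Graph G
    module H = Graph H
  field
    bijection : Inverse G.vertices H.vertices
  open Inverse bijection public using (to; from)
  field
    Adj⇔ : ∀ x y → G.Adj x y ⇔ H.Adj (to x) (to y)

------------------------------------------------------------------------
-- The quotient graph by the twin relation

module Twin {v e a : Level} (G : Graph v e a) where
  open Graph G
  private module V = Setoid vertices

  -- N(x) ∖ {u, w}
  N[_]∖⟨_,_⟩ : Vertex → Vertex → Vertex → Pred Vertex (e ⊔ a)
  N[ x ]∖⟨ u , w ⟩ y = Adj x y × y ≉ u × y ≉ w

  infix 4 _∼′_
  _∼′_ : Rel Vertex (v ⊔ e ⊔ a)
  x ∼′ y = N[ x ]∖⟨ x , y ⟩ ≐ N[ y ]∖⟨ x , y ⟩

  private
    refl′ : ∀ {x} → x ∼′ x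
    refl′ = (λ h → h) , (λ h → h)

    sym′ : ∀ {x y} → x ∼′ y → y ∼′ x
    sym′ (f , g) = (λ (p , q , r) → let (p′ , q′ , r′) = g (p , r , q) in p′ , r′ , q′)
                 , (λ (p , q , r) → let (p′ , q′ , r′) = f (p , r , q) in p′ , r′ , q′)

    ≈⇒∼′ : ∀ {x y} → x ≈ y → x ∼′ y
    ≈⇒∼′ x≈y = (λ (p , q) → proj₂ Adj-resp-≈ x≈y p , q)
             , (λ (p , q) → proj₂ Adj-resp-≈ (V.sym x≈y) p , q)

    transfer : Decidable _≈_ → ∀ {x y z} → x ∼′ y → y ∼′ z →
               ∀ {w} → Adj x w → w ≉ x → w ≉ z → Adj z w
    transfer _≟_ {x} {y} {z} (f , _) (g , _) {w} xw w≉x w≉z with w ≟ y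
    ... | no  w≉y = proj₁ (g (proj₁ (f (xw , w≉x , w≉y)) , w≉y , w≉z))
    ... | yes w≈y with x ≟ z
    ...   | yes x≈z = proj₂ Adj-resp-≈ x≈z xw
    ...   | no  x≉z = proj₁ Adj-resp-≈ (V.sym w≈y) (Adj-sym yz)
      where
      yx : Adj y x
      yx = Adj-sym (proj₁ Adj-resp-≈ w≈y xw)
      zx : Adj z x
      zx = proj₁ (g (yx , (λ x≈y → w≉x (V.trans w≈y (V.sym x≈y))) , x≉z))
      xz : Adj x z
      xz = Adj-sym zx
      yz : Adj y z
      yz = proj₁ (f (xz , (λ z≈x → x≉z (V.sym z≈x))
                        , (λ z≈y → w≉z (V.trans w≈y (V.sym z≈y)))))

    trans′ : Decidable _≈_ → ∀ {x y z} → x ∼′ y → y ∼′ z → x ∼′ z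
    trans′ _≟_ p q =
        (λ (xw , w≉x , w≉z) → transfer _≟_ p q xw w≉x w≉z , w≉x , w≉z)
      , (λ (zw , w≉x , w≉z) → transfer _≟_ (sym′ q) (sym′ p) zw w≉z w≉x , w≉x , w≉z)

  -- Decidability of vertex equality is only used for transitivity of ∼′;
  -- neither the vertices nor the edges of G_{E′} depend on it.
  twinSetoid : Decidable _≈_ → Setoid v (v ⊔ e ⊔ a)
  twinSetoid _≟_ = record
    { Carrier       = Vertex
    ; _≈_           = _∼′_
    ; isEquivalence = record { refl = refl′ ; sym = sym′ ; trans = trans′ _≟_ }
    }

  -- The class [ x ]′ is represented by x.
  G-E′ : Decidable _≈_ → Graph v (v ⊔ e ⊔ a) (v ⊔ e ⊔ a)
  G-E′ _≟_ = record
    { vertices   = twinSetoid _≟_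
    ; Adj        = λ x y → ¬ (x ∼′ y) × ∃₂ λ u w → u ∼′ x × w ∼′ y × Adj u w
    ; Adj-resp-≈ = (λ y∼z (x≁y , u , w , u∼x , w∼y , uw) →
                       (λ x∼z → x≁y (trans′ _≟_ x∼z (sym′ y∼z)))
                       , u , w , u∼x , trans′ _≟_ w∼y y∼z , uw)
                 , (λ x∼z (x≁y , u , w , u∼x , w∼y , uw) →
                       (λ z∼y → x≁y (trans′ _≟_ x∼z z∼y))
                       , u , w , trans′ _≟_ u∼x x∼z , w∼y , uw)
    ; Adj-sym    = λ (x≁y , u , w , u∼x , w∼y , uw) →
                       (λ y∼x → x≁y (sym′ y∼x)) , w , u , w∼y , u∼x , Adj-sym uw
    ; Adj⇒≉      = proj₁
    }

------------------------------------------------------------------------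
-- Zero divisor graphs

module _ {c ℓ : Level} (Q : CommutativeRing c ℓ) where
  open CommutativeRing Q

  -- As in the classical convention for Z(Q), 0 itself is a zero divisor of a
  -- non-zero ring.
  Z : Pred Carrier (c ⊔ ℓ)
  Z r = ∃ λ s → s ≉ 0# × r * s ≈ 0#

  Γ : Graph (c ⊔ ℓ) ℓ ℓ
  Γ = record
    { vertices   = record
      { Carrier       = ∃ λ r → Z r × r ≉ 0#
      ; _≈_           = _≈_ on proj₁
      ; isEquivalence = On.isEquivalence proj₁ isEquivalence
      }
    ; Adj        = λ (r , _) (s , _) → r ≉ s × r * s ≈ 0#
    ; Adj-resp-≈ = (λ s≈t (r≉s , rs≈0) →
                       (λ r≈t → r≉s (trans r≈t (sym s≈t)))
                       , trans (*-congˡ (sym s≈t)) rs≈0)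
                 , (λ r≈t (r≉s , rs≈0) →
                       (λ t≈s → r≉s (trans r≈t t≈s))
                       , trans (*-congʳ (sym r≈t)) rs≈0)
    ; Adj-sym    = λ (r≉s , rs≈0) → (λ s≈r → r≉s (sym s≈r)) , trans (*-comm _ _) rs≈0
    ; Adj⇒≉      = proj₁
    }

  Γ-E′ : Finite setoid → Graph (c ⊔ ℓ) (c ⊔ ℓ) (c ⊔ ℓ)
  Γ-E′ finite = Twin.G-E′ Γ (On.decidable proj₁ _≈_ (finite⇒decidable setoid finite))

------------------------------------------------------------------------
-- Integral covering graphs

D : ∀ {n} → Vector ℕ n → Graph _ _ _
D {n} m = record
  { vertices   = record
    { Carrier       = Vertex
    ; _≈_           = _≗_ on proj₁
    ; isEquivalence = On.isEquivalence proj₁ (Setoid.isEquivalence (Fin n ≡.→-setoid ℕ))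
    }
  ; Adj        = λ (v , _) (w , _) → ¬ (v ≗ w) × (∀ i → m i ℕ.≤ v i ℕ.+ w i)
  ; Adj-resp-≈ = (λ {v} w≈z (v≉w , cov) →
                     (λ v≈z → v≉w (λ i → ≡.trans (v≈z i) (≡.sym (w≈z i))))
                     , λ i → ≡.subst (λ k → m i ℕ.≤ proj₁ v i ℕ.+ k) (w≈z i) (cov i))
               , (λ {w} v≈z (v≉w , cov) →
                     (λ z≈w → v≉w (λ i → ≡.trans (v≈z i) (z≈w i)))
                     , λ i → ≡.subst (λ k → m i ℕ.≤ k ℕ.+ proj₁ w i) (v≈z i) (cov i))
  ; Adj-sym    = λ {v} {w} (v≉w , cov) →
                     (λ w≈v → v≉w (λ i → ≡.sym (w≈v i)))
                     , λ i → ≡.subst (m i ℕ.≤_) (ℕₚ.+-comm (proj₁ v i) (proj₁ w i)) (cov i)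
  ; Adj⇒≉      = proj₁
  }
  where
  Vertex : Set
  Vertex = Σ (Vector ℕ n) λ v →
    (∀ i → v i ℕ.≤ m i) × ¬ (v ≗ λ _ → 0) × ¬ (v ≗ m)

{-# OPTIONS --safe #-}

-- An element x of Q = R/(p₁^m₁ p₂^m₂) has a truncated valuation vector
-- ν x = (min(v_{p₁}(x), m₁), min(v_{p₂}(x), m₂)), and xy = 0 in Q iff
-- ν x + ν y ≥ m; so elements with equal valuations are twins.  Conversely, if
-- ν x ≠ ν y and m ≠ (1,1), a vector z different from ν x and ν y can be chosen
-- which covers m together with exactly one of them, and the vertex
-- p₁^z₁ p₂^z₂ then shows that x and y are not twins.  Hence ν induces the
-- isomorphism.
module Submission where

open import Defs
open import Algebra.Bundles using (CommutativeRing)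
open import Data.Nat using (ℕ; _≤_)
open import Data.Product using (_,_)
open import Data.Vec.Functional using (_∷_; [])
open import Relation.Binary.PropositionalEquality using (_≢_)
open import Relation.Nullary using (¬_)

open import Data.Empty using (⊥-elim)
open import Data.Fin using (zero; suc)
open import Data.Nat using (zero; suc; z≤n; s≤s; _+_; _∸_; _<_; _≟_; s≤s⁻¹)
open import Data.Nat.Properties using (≤-refl; ≤-trans; ≤-reflexive; ≤-antisym;
  <-cmp; <⇒≱; <⇒≢; n≮0; n≤1+n; 1+n≢n; m≤n⇒m≤1+n; m≤n⇒m<n∨m≡n; m≤n⇒∃[o]m+o≡n; m≤m+n; m≤n+m;
  +-comm; +-suc; +-mono-≤; +-monoʳ-≤; +-cancelʳ-≤; m+[n∸m]≡n; m∸n≤m; n≤0⇒n≡0)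
open import Data.Product using (∃; ∃₂; _×_; proj₁; proj₂; swap)
open import Data.Sum as Sum using (_⊎_; inj₁; inj₂; [_,_]′)
open import Function.Base using (_∘_)
open import Function.Bundles using (_⇔_; mk⇔; module Equivalence)
open import Relation.Binary.Bundles using (Setoid)
open import Relation.Binary.Core using (Rel)
open import Relation.Binary.Definitions using (Decidable; tri<; tri≈; tri>)
open import Relation.Binary.PropositionalEquality as ≡ using (_≡_; cong; cong₂; subst; subst₂; _≗_)
open import Relation.Nullary using (Dec; yes; no)
open import Relation.Nullary.Decidable using (decidable-stable)
import Relation.Unary as U
open import Data.Vec.Functional using (Vector)
open import Level using (_⊔_)
import Algebra.Definitions.RawMagma as MagmaDefs
import Algebra.Properties.CommutativeSemigroup as CommSemigroupProperties
import Algebra.Properties.CommutativeSemigroup.Divisibility as CommSemigroupDivisibility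
import Algebra.Properties.Ring as RingProperties
import Algebra.Properties.Semiring.Divisibility as SemiringDivisibility
import Algebra.Properties.Semiring.Exp as SemiringExp

open Equivalence using (to; from)

-- Covering vectors

infix 4 _≤₂_
infixl 6 _+₂_

_≤₂_ : Rel (ℕ × ℕ) _
(a₁ , a₂) ≤₂ (b₁ , b₂) = a₁ ≤ b₁ × a₂ ≤ b₂

_+₂_ : ℕ × ℕ → ℕ × ℕ → ℕ × ℕ
(a₁ , a₂) +₂ (b₁ , b₂) = a₁ + b₁ , a₂ + b₂

-- The conditions `z ≢ v` and `z ≢ w` mirror the removal of both vertices from the neighbourhoods in
-- the twin relation.
Separated : (m v w : ℕ × ℕ) → Set
Separated m v w = ∃ λ z → z ≤₂ m × z ≢ v × z ≢ w × ¬ (m ≤₂ v +₂ z ⇔ m ≤₂ w +₂ z)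

Separated-sym : ∀ {m v w} → Separated m v w → Separated m w v
Separated-sym (z , z≤m , z≢v , z≢w , ¬⇔) =
  z , z≤m , z≢w , z≢v , λ h → ¬⇔ (mk⇔ (from h) (to h))

Separated-swap : ∀ {m v w} → Separated (swap m) (swap v) (swap w) → Separated m v w
Separated-swap (z , z≤m , z≢v , z≢w , ¬⇔) =
  swap z , swap z≤m , z≢v ∘ cong swap , z≢w ∘ cong swap ,
  λ h → ¬⇔ (mk⇔ (swap ∘ to h ∘ swap) (swap ∘ from h ∘ swap))

-- Of the two candidates `n` and `suc n` at most one equals `c`; this picks a second coordinate of
-- `m₂ − 1` or `m₂`.
avoid : ∀ c n → ∃ λ t → n ≤ t × t ≤ suc n × t ≢ c
avoid c n with n ≟ c
... | no  n≢c    = n , ≤-refl , n≤1+n n , n≢c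
... | yes ≡.refl = suc n , n≤1+n n , ≤-refl , 1+n≢n

-- A vector z with z₁ = m₁ − w₁ = k covers m with w, provided z₂ ≥ m₂ − w₂, but
-- not with v.  If w₂ ≥ 1, both (k , m₂) and (k , m₂ − 1) qualify, and at most
-- one of v and w starts with k.  If w₂ = 0, only v = (k , m₂) can be in the way,
-- and that case is treated by hand.
separated-+ : ∀ k {m₂ v₁ v₂ w₁ w₂} → 1 ≤ m₂ → ¬ (w₁ + k ≡ 1 × m₂ ≡ 1) → v₁ < w₁ →
              Separated (w₁ + k , m₂) (v₁ , v₂) (w₁ , w₂)
separated-+ k {suc n} {v₁} {v₂} {w₁} {w₂} _ m≢1 v₁<w₁ = separate w₂ ≡.refl
  where
  m v w : ℕ × ℕ
  m = w₁ + k , suc n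
  v = v₁ , v₂
  w = w₁ , w₂

  not-v : ∀ {t} → ¬ m ≤₂ v +₂ (k , t)
  not-v (h , _) = <⇒≱ v₁<w₁ (+-cancelʳ-≤ k w₁ v₁ h)

  by-w : ∀ t → t ≤ suc n → (k , t) ≢ v → (k , t) ≢ w → suc n ≤ w₂ + t → Separated m v w
  by-w t t≤ ≢v ≢w cov =
    (k , t) , (m≤n+m k w₁ , t≤) , ≢v , ≢w , λ h → not-v (from h (≤-refl , cov))

  separate-0 : ∀ n k w₁ → ¬ (w₁ + k ≡ 1 × suc n ≡ 1) → k < w₁ →
               Separated (w₁ + k , suc n) (k , suc n) (w₁ , 0)
  -- For `m₂ ≥ 2`, `(w₁ , 1)` covers with `v`, while its sum with `w` has second coordinate only 1.
  separate-0 (suc n) k w₁ _ _ =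
    (w₁ , 1) , (m≤m+n w₁ k , s≤s z≤n) , (λ ()) , (λ ()) ,
    λ h → <⇒≱ (s≤s (s≤s z≤n)) (proj₂ (to h (≤-reflexive (+-comm w₁ k) , m≤m+n _ _)))
  -- For `m₂ = 1` and first coordinate of `v` at least 1, `w₁ + 1` still fits below `m₁`; the zero
  -- beside it rules out covering with `w`.
  separate-0 zero (suc k) w₁ _ _ =
    (suc w₁ , 0) , (≤-trans (s≤s (m≤m+n w₁ k)) (≤-reflexive (≡.sym (+-suc w₁ k))) , z≤n) ,
    (λ ()) , (λ e → 1+n≢n (cong proj₁ e)) ,
    λ h → n≮0 (proj₂ (to h
      (≤-trans (≤-reflexive (+-comm w₁ (suc k))) (+-monoʳ-≤ (suc k) (n≤1+n w₁)) , ≤-refl)))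
  -- This is the excluded case `m = (1 , 1)`.
  separate-0 zero zero (suc zero) m≢1 _ = ⊥-elim (m≢1 (≡.refl , ≡.refl))
  -- Here `v = (0 , 1)` and `m₁ ≥ 2`, so `(1 , 1)` covers with `w` but reaches only 1 in the first
  -- coordinate with `v`.
  separate-0 zero zero (suc (suc w₁)) _ _ =
    (1 , 1) , (s≤s z≤n , ≤-refl) , (λ ()) , (λ ()) ,
    λ h → <⇒≱ (s≤s (s≤s z≤n)) (proj₁ (from h (+-monoʳ-≤ (suc (suc w₁)) z≤n , ≤-refl)))

  separate : ∀ x → w₂ ≡ x → Separated m v w
  separate zero ≡.refl with k ≟ v₁ | suc n ≟ v₂
  ... | yes ≡.refl | yes ≡.refl = separate-0 n k w₁ m≢1 v₁<w₁
  ... | no k≢v₁    | _          = by-w (suc n) ≤-refl (k≢v₁ ∘ cong proj₁) (λ ()) ≤-refl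
  ... | _          | no n≢v₂    = by-w (suc n) ≤-refl (n≢v₂ ∘ cong proj₂) (λ ()) ≤-refl
  separate (suc x) ≡.refl with k ≟ v₁
  ... | yes ≡.refl = let t , n≤t , t≤ , t≢v₂ = avoid v₂ n in
    by-w t t≤ (t≢v₂ ∘ cong proj₂) (<⇒≢ v₁<w₁ ∘ cong proj₁) (s≤s (≤-trans n≤t (m≤n+m t x)))
  ... | no k≢v₁    = let t , n≤t , t≤ , t≢w₂ = avoid w₂ n in
    by-w t t≤ (k≢v₁ ∘ cong proj₁) (t≢w₂ ∘ cong proj₂) (s≤s (≤-trans n≤t (m≤n+m t x)))

separated-< : ∀ {m₁ m₂ v₁ v₂ w₁ w₂} → 1 ≤ m₂ → ¬ (m₁ ≡ 1 × m₂ ≡ 1) → w₁ ≤ m₁ →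
              v₁ < w₁ → Separated (m₁ , m₂) (v₁ , v₂) (w₁ , w₂)
separated-< 1≤m₂ m≢1 w₁≤m₁ v₁<w₁ with k , ≡.refl ← m≤n⇒∃[o]m+o≡n w₁≤m₁ =
  separated-+ k 1≤m₂ m≢1 v₁<w₁

separated-≢ : ∀ {m₁ m₂ v₁ v₂ w₁ w₂} → 1 ≤ m₂ → ¬ (m₁ ≡ 1 × m₂ ≡ 1) →
              v₁ ≤ m₁ → w₁ ≤ m₁ → v₁ ≢ w₁ → Separated (m₁ , m₂) (v₁ , v₂) (w₁ , w₂)
separated-≢ {v₁ = v₁} {w₁ = w₁} 1≤m₂ m≢1 v₁≤m₁ w₁≤m₁ v₁≢w₁ with <-cmp v₁ w₁
... | tri< v₁<w₁ _ _ = separated-< 1≤m₂ m≢1 w₁≤m₁ v₁<w₁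
... | tri≈ _ v₁≡w₁ _ = ⊥-elim (v₁≢w₁ v₁≡w₁)
... | tri> _ _ w₁<v₁ = Separated-sym (separated-< 1≤m₂ m≢1 v₁≤m₁ w₁<v₁)

-- A difference in either coordinate would yield a separating vector; the second coordinate is
-- reduced to the first by exchanging the two.
covers-same⇒≡ : ∀ {m v w} → (1 , 1) ≤₂ m → ¬ (proj₁ m ≡ 1 × proj₂ m ≡ 1) → v ≤₂ m → w ≤₂ m →
                (∀ z → z ≤₂ m → z ≢ v → z ≢ w → (m ≤₂ v +₂ z ⇔ m ≤₂ w +₂ z)) → v ≡ w
covers-same⇒≡ {m} {v} {w} (1≤m₁ , 1≤m₂) m≢1 (v₁≤m₁ , v₂≤m₂) (w₁≤m₁ , w₂≤m₂) same =
  cong₂ _,_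
    (decidable-stable (_ ≟ _) (inseparable ∘ separated-≢ 1≤m₂ m≢1 v₁≤m₁ w₁≤m₁))
    (decidable-stable (_ ≟ _) (inseparable ∘ Separated-swap ∘
      separated-≢ 1≤m₁ (m≢1 ∘ swap) v₂≤m₂ w₂≤m₂))
  where
  inseparable : ¬ Separated m v w
  inseparable (z , z≤m , z≢v , z≢w , ¬⇔) = ¬⇔ (same z z≤m z≢v z≢w)

-- Pairs as vectors of length two, and bounded search

vector : ℕ × ℕ → Vector ℕ 2
vector (a , b) = a ∷ b ∷ []

pair : Vector ℕ 2 → ℕ × ℕ
pair v = v zero , v (suc zero)

pair-≡⇒≗ : ∀ {v w} → pair v ≡ pair w → v ≗ w
pair-≡⇒≗ e zero       = cong proj₁ e
pair-≡⇒≗ e (suc zero) = cong proj₂ e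

≗⇒pair-≡ : ∀ {v w} → v ≗ w → pair v ≡ pair w
≗⇒pair-≡ v≗w = cong₂ _,_ (v≗w zero) (v≗w (suc zero))

≤₂⇒≤ : ∀ {v w : Vector ℕ 2} → pair v ≤₂ pair w → ∀ i → v i ≤ w i
≤₂⇒≤ (h , _) zero       = h
≤₂⇒≤ (_ , h) (suc zero) = h

-- The search runs downwards from `m` and stops at 0 at the latest, by `P 0`.
greatest : ∀ {p} {P : ℕ → Set p} → U.Decidable P → P 0 → ∀ m →
           ∃ λ k → k ≤ m × P k × (∀ {j} → j ≤ m → P j → j ≤ k)
greatest P? P0 zero = 0 , z≤n , P0 , λ j≤0 _ → j≤0
greatest P? P0 (suc m) with P? (suc m)
... | yes Pm = suc m , ≤-refl , Pm , λ j≤m _ → j≤m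
... | no ¬Pm with k , k≤m , Pk , max ← greatest P? P0 m =
  k , m≤n⇒m≤1+n k≤m , Pk , λ j≤ Pj →
    [ (λ j<1+m → max (s≤s⁻¹ j<1+m) Pj) , (λ { ≡.refl → ⊥-elim (¬Pm Pj) }) ]′ (m≤n⇒m<n∨m≡n j≤)

-- Twins in a zero divisor graph

module _ {c ℓ} (Q : CommutativeRing c ℓ) where
  open CommutativeRing Q renaming (_+_ to _+ᴿ_)
  open Graph (Γ Q) using (Vertex)
  open Twin (Γ Q)

  -- The twin relation only tests vertices. A non-zero `e` with `x * e ≈ 0#` is one, with `x` as
  -- witness; `e ≈ 0#` is trivial.
  ∼′⇒annihilates : Decidable _≈_ → {x y : Vertex} → x ∼′ y →
                   ∀ e → e ≉ proj₁ x → e ≉ proj₁ y →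
                   proj₁ x * e ≈ 0# → proj₁ y * e ≈ 0#
  ∼′⇒annihilates _≈?_ {x , _ , x≉0} {y , _} (N⊆ , _) e e≉x e≉y xe≈0 with e ≈? 0#
  ... | yes e≈0 = trans (*-congˡ e≈0) (zeroʳ y)
  ... | no  e≉0 = proj₂ (proj₁ (N⊆ {e , (x , x≉0 , trans (*-comm e x) xe≈0) , e≉0}
                    (((λ x≈e → e≉x (sym x≈e)) , xe≈0) , e≉x , e≉y)))

  -- Besides the vanishing product, adjacency asks only for distinctness, which the removal of both
  -- `x` and `y` supplies.
  annihilators⇒∼′ : {x y : Vertex} → (∀ e → (proj₁ x * e ≈ 0# ⇔ proj₁ y * e ≈ 0#)) → x ∼′ y
  annihilators⇒∼′ same =
      (λ {z} ((_ , xz≈0) , z≉x , z≉y) →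
        ((λ y≈z → z≉y (sym y≈z)) , to (same (proj₁ z)) xz≈0) , z≉x , z≉y)
    , (λ {z} ((_ , yz≈0) , z≉x , z≉y) →
        ((λ x≈z → z≉x (sym x≈z)) , from (same (proj₁ z)) yz≈0) , z≉x , z≉y)

-- Prime powers in a principal ideal domain

module _ {c ℓ} (R : CommutativeRing c ℓ) where
  open RingTheory R hiding (zero) renaming (_+_ to _+ᴿ_)
  open SemiringDivisibility semiring using (∣-refl; ∣-trans; ∣-respˡ-≈; ∣-respʳ-≈; 1∣_; 0∣x⇒x≈0)
  open CommSemigroupDivisibility *-commutativeSemigroup
    using (∙-cong-∣; x∣y⇒zx∣zy; x∣xy)
  open CommSemigroupProperties *-commutativeSemigroup using (x∙yz≈y∙xz)
  open SemiringExp semiring using (^-homo-*)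
  open RingProperties ring
    using (x[y-z]≈xy-xz; x∙y⁻¹≈ε⇒x≈y; x≈y⇒x∙y⁻¹≈ε; -0#≈0#; //-rightDividesˡ)

  -- The ideal {x ∣ x ≈ 0 or P} is (0) or R according to whether P fails or holds.
  IsPID⇒excluded-middle : IsPID → (P : Set (c ⊔ ℓ)) → Dec P
  IsPID⇒excluded-middle pid P = decide (proj₂ I-gen (∣-refl {h}))
    where
    open IsPID pid
    I : Ideal (c ⊔ ℓ)
    I = record
      { Member   = λ x → x ≈ 0# ⊎ P
      ; resp-≈   = λ x≈y → Sum.map₁ (trans (sym x≈y))
      ; 0∈       = inj₁ refl
      ; +-closed = λ { (inj₁ x≈0) (inj₁ y≈0) → inj₁ (trans (+-cong x≈0 y≈0) (+-identityˡ 0#))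
                     ; (inj₂ p) _ → inj₂ p
                     ; _ (inj₂ p) → inj₂ p }
      ; *-closed = λ r → Sum.map₁ λ x≈0 → trans (*-congˡ x≈0) (zeroʳ r)
      }
    h = proj₁ (principal I)
    I-gen = proj₂ (principal I)
    decide : h ≈ 0# ⊎ P → Dec P
    decide (inj₂ p)   = yes p
    decide (inj₁ h≈0) = no λ p → IsIntegralDomain.1≉0 isIntegralDomain
      (0∣x⇒x≈0 (∣-respˡ-≈ h≈0 (proj₁ I-gen (inj₂ p))))

  x-0≈x : ∀ x → x - 0# ≈ x
  x-0≈x x = trans (+-congˡ -0#≈0#) (+-identityʳ x)

  module _ (domain : IsIntegralDomain) where
    open IsIntegralDomain domain

    *-cancelˡ : ∀ {a x y} → a ≉ 0# → a * x ≈ a * y → x ≈ y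
    *-cancelˡ {a} {x} {y} a≉0 ax≈ay = [ (λ a≈0 → ⊥-elim (a≉0 a≈0)) , x∙y⁻¹≈ε⇒x≈y x y ]′
      (noZeroDivisors (trans (x[y-z]≈xy-xz a x y) (x≈y⇒x∙y⁻¹≈ε ax≈ay)))

    ∣-cancelˡ : ∀ {a x y} → a ≉ 0# → a * x ∣ a * y → x ∣ y
    ∣-cancelˡ {a} {x} a≉0 (q MagmaDefs., e) =
      q MagmaDefs., *-cancelˡ a≉0 (trans (x∙yz≈y∙xz a q x) e)

    -- One factor `p` is peeled off at a time: it divides `x` or `y` by primality, and cancelling it
    -- lowers the exponent.
    ^-∣-* : ∀ {p} → Prime p → ∀ m {x y} → p ^ m ∣ x * y →
            ∃₂ λ i j → i + j ≡ m × p ^ i ∣ x × p ^ j ∣ y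
    ^-∣-* prime zero _ = 0 , 0 , ≡.refl , (1∣ _) , (1∣ _)
    ^-∣-* {p} prime (suc m) {x} {y} p∣xy =
      [ left , right ]′ (Prime.split-∣ prime (∣-trans (x∣xy p (p ^ m)) p∣xy))
      where
      left : p ∣ x → _
      left (q MagmaDefs., qp≈x) with pq≈x ← trans (*-comm p q) qp≈x
        with i , j , i+j≡m , pⁱ∣q , pʲ∣y ← ^-∣-* prime m (∣-cancelˡ (Prime.p≉0 prime)
               (∣-respʳ-≈ (trans (*-congʳ (sym pq≈x)) (*-assoc p q y)) p∣xy)) =
        suc i , j , cong suc i+j≡m , ∣-respʳ-≈ pq≈x (x∣y⇒zx∣zy p pⁱ∣q) , pʲ∣y
      right : p ∣ y → _
      right (q MagmaDefs., qp≈y) with pq≈y ← trans (*-comm p q) qp≈y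
        with i , j , i+j≡m , pⁱ∣x , pʲ∣q ← ^-∣-* prime m (∣-cancelˡ (Prime.p≉0 prime)
               (∣-respʳ-≈ (trans (*-congˡ (sym pq≈y)) (x∙yz≈y∙xz x p q)) p∣xy)) =
        i , suc j , ≡.trans (+-suc i j) (cong suc i+j≡m) , pⁱ∣x ,
        ∣-respʳ-≈ pq≈y (x∣y⇒zx∣zy p pʲ∣q)

    ^-∣-^ : ∀ {p} → Prime p → ∀ i {j} → p ^ i ∣ p ^ j → i ≤ j
    ^-∣-^ prime zero _ = z≤n
    ^-∣-^ {p} prime (suc i) {zero} pⁱ∣1 = ⊥-elim (Prime.p∤1 prime (∣-trans (x∣xy p (p ^ i)) pⁱ∣1))
    ^-∣-^ prime (suc i) {suc j} pⁱ∣pʲ = s≤s (^-∣-^ prime i (∣-cancelˡ (Prime.p≉0 prime) pⁱ∣pʲ))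

    -- Write `q = r p`. If `q ∣ r`, then `q p ∣ q` and `p` would be a unit; so `q ∣ p`. Hence for
    -- non-associated primes neither divides the other.
    prime-∣-prime : ∀ {p q} → Prime p → Prime q → p ∣ q → q ∣ p
    prime-∣-prime {p} {q} P-p P-q (r MagmaDefs., rp≈q) =
      [ (λ q∣r → ⊥-elim (Prime.p∤1 P-p (∣-cancelˡ (Prime.p≉0 P-q)
          (∣-respʳ-≈ (trans rp≈q (sym (*-identityʳ q))) (∙-cong-∣ q∣r ∣-refl)))))
      , (λ q∣p → q∣p) ]′
      (Prime.split-∣ P-q (∣-respʳ-≈ (sym rp≈q) ∣-refl))

  prime-∤-^ : ∀ {p q} → Prime p → ¬ p ∣ q → ∀ n → ¬ p ∣ q ^ n
  prime-∤-^ prime p∤q zero    p∣1 = Prime.p∤1 prime p∣1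
  prime-∤-^ prime p∤q (suc n) p∣  = [ p∤q , prime-∤-^ prime p∤q n ]′ (Prime.split-∣ prime p∣)

  ^-monoʳ-∣ : ∀ p {i j} → i ≤ j → p ^ i ∣ p ^ j
  ^-monoʳ-∣ p z≤n       = 1∣ _
  ^-monoʳ-∣ p (s≤s i≤j) = x∣y⇒zx∣zy p (^-monoʳ-∣ p i≤j)

  module _ (domain : IsIntegralDomain) {p} (prime : Prime p) where

    -- When `p ^ m` is split between `x` and `y`, the share of `x` must be trivial.
    ^-∣-*-coprime : ∀ m {x y} → ¬ p ∣ x → p ^ m ∣ x * y → p ^ m ∣ y
    ^-∣-*-coprime m p∤x p∣xy with ^-∣-* domain prime m p∣xy
    ... | zero  , _ , ≡.refl , _    , pʲ∣y = pʲ∣y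
    ... | suc i , _ , _      , pⁱ∣x , _    = ⊥-elim (p∤x (∣-trans (x∣xy p (p ^ i)) pⁱ∣x))

    -- The valuation at `p`, truncated at `m` and so defined at zero too

    module TruncatedValuation (p^_∣?_ : ∀ k x → Dec (p ^ k ∣ x)) (m : ℕ) where

      private
        largest : ∀ x → _
        largest x = greatest (p^_∣? x) (1∣ x) m

      ν : Carrier → ℕ
      ν x = proj₁ (largest x)

      ν≤m : ∀ x → ν x ≤ m
      ν≤m x = proj₁ (proj₂ (largest x))

      ^ν∣ : ∀ x → p ^ ν x ∣ x
      ^ν∣ x = proj₁ (proj₂ (proj₂ (largest x)))

      ν-max : ∀ {j} x → j ≤ m → p ^ j ∣ x → j ≤ ν x
      ν-max x = proj₂ (proj₂ (proj₂ (largest x)))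

      ν-cong : ∀ {x y} → p ^ m ∣ x - y → ν x ≡ ν y
      ν-cong {x} {y} pᵐ∣x-y = ≤-antisym (ν-≤ (Q.sym {x} {y} pᵐ∣x-y)) (ν-≤ pᵐ∣x-y)
        where
        module Q = CommutativeRing (quotientRing ⟨ p ^ m ⟩)
        ν-≤ : ∀ {x y} → p ^ m ∣ x - y → ν y ≤ ν x
        -- In `x = (x - y) + y` both summands are divisible by `p ^ ν y`, since `ν y ≤ m`.
        ν-≤ {x} {y} pᵐ∣x-y = ν-max x (ν≤m y) (∣-respʳ-≈ (//-rightDividesˡ y x)
          (Ideal.+-closed ⟨ p ^ ν y ⟩ (∣-trans (^-monoʳ-∣ p (ν≤m y)) pᵐ∣x-y) (^ν∣ y)))

      -- Splitting `p ^ m` over `x` and `y` gives exponents that sum to `m`, hence are at most `m`: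
      -- truncation loses nothing.
      ^∣-*⇔ : ∀ x y → p ^ m ∣ x * y ⇔ m ≤ ν x + ν y
      ^∣-*⇔ x y = mk⇔ ⇒ ⇐
        where
        ⇒ : p ^ m ∣ x * y → m ≤ ν x + ν y
        ⇒ pᵐ∣xy with ^-∣-* domain prime m pᵐ∣xy
        ... | i , j , i+j≡m , pⁱ∣x , pʲ∣y = ≤-trans (≤-reflexive (≡.sym i+j≡m))
          (+-mono-≤ (ν-max x (≤-trans (m≤m+n i j) (≤-reflexive i+j≡m)) pⁱ∣x)
                    (ν-max y (≤-trans (m≤n+m j i) (≤-reflexive i+j≡m)) pʲ∣y))
        ⇐ : m ≤ ν x + ν y → p ^ m ∣ x * y
        ⇐ m≤ = ∣-trans (^-monoʳ-∣ p m≤)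
          (∣-respˡ-≈ (sym (^-homo-* p (ν x) (ν y))) (∙-cong-∣ (^ν∣ x) (^ν∣ y)))

      ∣⇒m≤ν : ∀ x → p ^ m ∣ x → m ≤ ν x
      ∣⇒m≤ν x = ν-max x ≤-refl

      m≤ν⇒∣ : ∀ x → m ≤ ν x → p ^ m ∣ x
      m≤ν⇒∣ x m≤ν = ∣-trans (^-monoʳ-∣ p m≤ν) (^ν∣ x)

      ν-^* : ∀ {a y} → a ≤ m → ¬ p ∣ y → ν (p ^ a * y) ≡ a
      ν-^* {a} {y} a≤m p∤y = ≤-antisym
        (^-∣-^ domain prime _ (^-∣-*-coprime (ν (p ^ a * y)) p∤y
          (∣-respʳ-≈ (*-comm (p ^ a) y) (^ν∣ (p ^ a * y)))))
        (ν-max (p ^ a * y) a≤m (x∣xy (p ^ a) y))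

-- The isomorphism induced by the pair of valuations

corollary74 : ∀ {c ℓ} (R : CommutativeRing c ℓ) →
    let open RingTheory R in
    IsPID →
    (g : Carrier) →
    IsProper ⟨ g ⟩ →
    ¬ IsPrimeIdeal ⟨ g ⟩ →
    let Q = quotientRing ⟨ g ⟩ in
    (finite : Finite (CommutativeRing.setoid Q)) →
    (u p₁ p₂ : Carrier) (m₁ m₂ : ℕ) →
    IsUnit u → Prime p₁ → Prime p₂ → p₁ ∦ p₂ →
    1 ≤ m₁ → 1 ≤ m₂ →
    g ≈ u * (p₁ ^ m₁ * p₂ ^ m₂) →
    (m₁ , m₂) ≢ (1 , 1) →
    Γ-E′ Q finite ≅ D (m₁ ∷ m₂ ∷ [])
corollary74 R pid g _ _ finite u p₁ p₂ m₁ m₂ u∣1 prime₁ prime₂ p₁∦p₂ 1≤m₁ 1≤m₂ g≈ m≢1 = record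
  { bijection = record
    { to        = toD
    ; from      = fromD
    ; to-cong   = λ {x} {y} x∼y → pair-≡⇒≗ (∼′⇒ν≡ {x} {y} x∼y)
    ; from-cong = λ {v} {w} v≗w → ν≡⇒∼′ {fromD v} {fromD w}
        (≡.trans (ν-fromD v) (≡.trans (≗⇒pair-≡ v≗w) (≡.sym (ν-fromD w))))
    ; inverse   = (λ {v} {x} x∼ → pair-≡⇒≗ (≡.trans (∼′⇒ν≡ {x} {fromD v} x∼) (ν-fromD v)))
                , (λ {x} {v} v≗ → ν≡⇒∼′ {fromD v} {x}
                    (≡.trans (ν-fromD v) (≗⇒pair-≡ v≗)))
    }
  ; Adj⇔ = λ x y → mk⇔ (Adj⇒ x y) (⇒Adj x y)
  }
  where
  open RingTheory R hiding (zero) renaming (_+_ to _+ᴿ_)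
  open IsPID pid using () renaming (isIntegralDomain to domain)
  open SemiringDivisibility semiring using (∣-refl; ∣-trans; ∣-respˡ-≈; ∣-respʳ-≈)
  open CommSemigroupDivisibility *-commutativeSemigroup using (∙-cong-∣; x∣xy; x∣yx)

  Q = quotientRing ⟨ g ⟩
  module Q = CommutativeRing Q
  open Graph (Γ Q) using (Vertex)
  open Twin (Γ Q) using (_∼′_)

  module ΓE = Graph (Γ-E′ Q finite)
  module DG = Graph (D (m₁ ∷ m₂ ∷ []))

  _≟Q_ = finite⇒decidable Q.setoid finite

  p₁∤p₂ : ¬ p₁ ∣ p₂
  p₁∤p₂ p₁∣p₂ = p₁∦p₂ (p₁∣p₂ , prime-∣-prime R domain prime₁ prime₂ p₁∣p₂)

  p₂∤p₁ : ¬ p₂ ∣ p₁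
  p₂∤p₁ p₂∣p₁ = p₁∦p₂ (prime-∣-prime R domain prime₂ prime₁ p₂∣p₁ , p₂∣p₁)

  module V₁ = TruncatedValuation R domain prime₁ (λ _ _ → IsPID⇒excluded-middle R pid _) m₁
  module V₂ = TruncatedValuation R domain prime₂ (λ _ _ → IsPID⇒excluded-middle R pid _) m₂

  m : ℕ × ℕ
  m = m₁ , m₂

  ν : Carrier → ℕ × ℕ
  ν x = V₁.ν x , V₂.ν x

  ν≤m : ∀ x → ν x ≤₂ m
  ν≤m x = V₁.ν≤m x , V₂.ν≤m x

  q∣g : p₁ ^ m₁ * p₂ ^ m₂ ∣ g
  q∣g = ∣-respʳ-≈ (sym g≈) (x∣yx _ u)

  p₁^m₁∣g : p₁ ^ m₁ ∣ g
  p₁^m₁∣g = ∣-trans (x∣xy _ _) q∣g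

  p₂^m₂∣g : p₂ ^ m₂ ∣ g
  p₂^m₂∣g = ∣-trans (x∣yx _ _) q∣g

  -- With `x = r * p₂ ^ m₂`, the power of `p₁` is coprime to that of `p₂` and so divides `r`. The
  -- unit `u` is absorbed through `u ∣ 1#`.
  g∣⇐ : ∀ {x} → p₁ ^ m₁ ∣ x → p₂ ^ m₂ ∣ x → g ∣ x
  g∣⇐ p₁∣x (r MagmaDefs., rp₂≈x) = ∣-respˡ-≈ (sym g≈) (∣-respʳ-≈ (*-identityˡ _)
    (∙-cong-∣ u∣1 (∣-respʳ-≈ rp₂≈x (∙-cong-∣
      (^-∣-*-coprime R domain prime₁ m₁ (prime-∤-^ R prime₁ p₁∤p₂ m₂)
        (∣-respʳ-≈ (trans (sym rp₂≈x) (*-comm r _)) p₁∣x))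
      ∣-refl))))

  ≈0⇔∣ : ∀ {x} → x Q.≈ Q.0# ⇔ g ∣ x
  ≈0⇔∣ {x} = mk⇔ (∣-respʳ-≈ (x-0≈x R x)) (∣-respʳ-≈ (sym (x-0≈x R x)))

  -- Divisibility by `g` can be tested at the two primes separately, which turns a vanishing product
  -- into the covering condition.
  *≈0⇔ : ∀ x y → x * y Q.≈ Q.0# ⇔ m ≤₂ ν x +₂ ν y
  *≈0⇔ x y = mk⇔
    (λ xy≈0 → let g∣xy = to ≈0⇔∣ xy≈0 in
      to (V₁.^∣-*⇔ x y) (∣-trans p₁^m₁∣g g∣xy) , to (V₂.^∣-*⇔ x y) (∣-trans p₂^m₂∣g g∣xy))
    (λ (m₁≤ , m₂≤) → from ≈0⇔∣ (g∣⇐ (from (V₁.^∣-*⇔ x y) m₁≤) (from (V₂.^∣-*⇔ x y) m₂≤)))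

  m≤ν⇒≈0 : ∀ x → m ≤₂ ν x → x Q.≈ Q.0#
  m≤ν⇒≈0 x (m₁≤ , m₂≤) = from ≈0⇔∣ (g∣⇐ (V₁.m≤ν⇒∣ x m₁≤) (V₂.m≤ν⇒∣ x m₂≤))

  ν-cong : ∀ {x y} → x Q.≈ y → ν x ≡ ν y
  ν-cong x≈y = cong₂ _,_ (V₁.ν-cong (∣-trans p₁^m₁∣g x≈y)) (V₂.ν-cong (∣-trans p₂^m₂∣g x≈y))

  monomial : ℕ × ℕ → Carrier
  monomial (a , b) = p₁ ^ a * p₂ ^ b

  ν-monomial : ∀ z → z ≤₂ m → ν (monomial z) ≡ z
  ν-monomial (a , b) (a≤ , b≤) = cong₂ _,_
    (V₁.ν-^* a≤ (prime-∤-^ R prime₁ p₁∤p₂ b))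
    (≡.trans (cong proj₂ (ν-cong (Q.*-comm (p₁ ^ a) (p₂ ^ b))))
      (V₂.ν-^* b≤ (prime-∤-^ R prime₂ p₂∤p₁ a)))

  ν≡⇒∼′ : ∀ {x y : Vertex} → ν (proj₁ x) ≡ ν (proj₁ y) → x ∼′ y
  ν≡⇒∼′ {x , x∈V} {y , y∈V} νx≡νy = annihilators⇒∼′ Q {x , x∈V} {y , y∈V} λ e → mk⇔
    (from (*≈0⇔ y e) ∘ subst (λ v → m ≤₂ v +₂ ν e) νx≡νy ∘ to (*≈0⇔ x e))
    (from (*≈0⇔ x e) ∘ subst (λ v → m ≤₂ v +₂ ν e) (≡.sym νx≡νy) ∘ to (*≈0⇔ y e))

  ∼′⇒ν≡ : ∀ {x y : Vertex} → x ∼′ y → ν (proj₁ x) ≡ ν (proj₁ y)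
  ∼′⇒ν≡ {x} {y} x∼y = covers-same⇒≡ (1≤m₁ , 1≤m₂) (λ (e₁ , e₂) → m≢1 (cong₂ _,_ e₁ e₂))
    (ν≤m _) (ν≤m _) λ z z≤m z≢νx z≢νy → mk⇔
      (covers {x} {y} x∼y z≤m z≢νx z≢νy)
      (covers {y} {x} (Setoid.sym ΓE.vertices {x} {y} x∼y) z≤m z≢νy z≢νx)
    where
    covers : ∀ {x y : Vertex} → x ∼′ y → ∀ {z} → z ≤₂ m → z ≢ ν (proj₁ x) → z ≢ ν (proj₁ y) →
             m ≤₂ ν (proj₁ x) +₂ z → m ≤₂ ν (proj₁ y) +₂ z
    covers {x} {y} x∼y {z} z≤m z≢νx z≢νy cov =
      subst (λ t → m ≤₂ ν (proj₁ y) +₂ t) (ν-monomial z z≤m) (to (*≈0⇔ _ _)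
        (∼′⇒annihilates Q _≟Q_ {x} {y} x∼y (monomial z)
          -- As `ν` respects equality in `Q`, a monomial equal to `x` would force `z ≡ ν x`.
          (λ e≈x → z≢νx (≡.trans (≡.sym (ν-monomial z z≤m)) (ν-cong e≈x)))
          (λ e≈y → z≢νy (≡.trans (≡.sym (ν-monomial z z≤m)) (ν-cong e≈y)))
          (from (*≈0⇔ _ _) (subst (λ t → m ≤₂ ν (proj₁ x) +₂ t)
            (≡.sym (ν-monomial z z≤m)) cov))))

  -- The two vertex maps

  toD : Vertex → DG.Vertex
  toD (x , (s , s≉0 , xs≈0) , x≉0) = vector (ν x) , ≤₂⇒≤ (ν≤m x)
    -- If `ν x` were zero, `x * s ≈ 0#` would put the full vector `m` on `s` and make `s` zero.
    , (λ νx≗0 → s≉0 (m≤ν⇒≈0 s (subst (λ v → m ≤₂ v +₂ ν s) (≗⇒pair-≡ νx≗0) (to (*≈0⇔ x s) xs≈0))))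
    , (λ νx≗m → x≉0 (m≤ν⇒≈0 x 
        (≤-reflexive (≡.sym (νx≗m zero)) , ≤-reflexive (≡.sym (νx≗m (suc zero))))))

  ≉0 : ∀ z → z ≤₂ m → ¬ m ≤₂ z → monomial z Q.≉ Q.0#
  ≉0 z z≤m m≰z e≈0 = m≰z (subst (m ≤₂_) (ν-monomial z z≤m)
    (V₁.∣⇒m≤ν _ (∣-trans p₁^m₁∣g g∣e) , V₂.∣⇒m≤ν _ (∣-trans p₂^m₂∣g g∣e)))
    where g∣e = to ≈0⇔∣ e≈0

  fromD : DG.Vertex → Vertex
  fromD (v , v≤m , v≢0 , v≢m) = monomial (pair v)
    -- The complementary exponents `z = m − v` give the annihilator; it is non-zero because `v` is
    -- not the zero vector.
    , (monomial z , ≉0 z z≤m (λ (h₁ , h₂) → v≢0 λ { zero → m≤m∸n⇒n≡0 (v≤m zero) h₁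
                                                  ; (suc zero) → m≤m∸n⇒n≡0 (v≤m (suc zero)) h₂ })
      , from (*≈0⇔ _ _) (subst₂ (λ a b → m ≤₂ a +₂ b) (≡.sym (ν-monomial (pair v) v≤₂m))
          (≡.sym (ν-monomial z z≤m))
          ( ≤-reflexive (≡.sym (m+[n∸m]≡n (v≤m zero)))
          , ≤-reflexive (≡.sym (m+[n∸m]≡n (v≤m (suc zero)))))))
    , ≉0 (pair v) v≤₂m (λ (h₁ , h₂) → v≢m λ { zero → ≤-antisym (v≤m zero) h₁
                                            ; (suc zero) → ≤-antisym (v≤m (suc zero)) h₂ })
    where
    v≤₂m : pair v ≤₂ m
    v≤₂m = v≤m zero , v≤m (suc zero)
    z : ℕ × ℕ
    z = m₁ ∸ v zero , m₂ ∸ v (suc zero)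
    z≤m : z ≤₂ m
    z≤m = m∸n≤m m₁ (v zero) , m∸n≤m m₂ (v (suc zero))
    m≤m∸n⇒n≡0 : ∀ {m n} → n ≤ m → m ≤ m ∸ n → n ≡ 0
    m≤m∸n⇒n≡0 {m} {n} n≤m m≤m∸n = n≤0⇒n≡0 (+-cancelʳ-≤ (m ∸ n) n 0
      (≤-trans (≤-reflexive (m+[n∸m]≡n n≤m)) m≤m∸n))

  ν-fromD : ∀ (v : DG.Vertex) → ν (proj₁ (fromD v)) ≡ pair (proj₁ v)
  ν-fromD (v , v≤m , _) = ν-monomial (pair v) (v≤m zero , v≤m (suc zero))

  -- Edges in both directions

  Adj⇒ : ∀ x y → ΓE.Adj x y → DG.Adj (toD x) (toD y)
  Adj⇒ x y (x≁y , a , b , a∼x , b∼y , _ , ab≈0) =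
      (λ νx≗νy → x≁y (ν≡⇒∼′ {x} {y} (≗⇒pair-≡ νx≗νy)))
    -- The edge comes from representatives `a` and `b`, whose valuations are those of `x` and `y`.
    , ≤₂⇒≤ (subst₂ (λ v w → m ≤₂ v +₂ w) (∼′⇒ν≡ {a} {x} a∼x) (∼′⇒ν≡ {b} {y} b∼y)
        (to (*≈0⇔ _ _) ab≈0))

  ⇒Adj : ∀ x y → DG.Adj (toD x) (toD y) → ΓE.Adj x y
  ⇒Adj x y (νx≢νy , cov) =
      (λ x∼y → νx≢νy (pair-≡⇒≗ (∼′⇒ν≡ {x} {y} x∼y)))
    , x , y , Setoid.refl ΓE.vertices {x} , Setoid.refl ΓE.vertices {y}
    , (λ x≈y → νx≢νy (pair-≡⇒≗ (ν-cong x≈y)))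
    , from (*≈0⇔ _ _) (cov zero , cov (suc zero))
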